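{- Let $b_0,b_1\in\mathbb{Q}_2$ be such that $F=(b_0x,\ 1+b_1x)$ and $G=(b_1x,\ 1+b_0x)$ are (linear-polynomial) $2$-adic systems, and let $\sigma:\{0,1\}\to\{0,1\}$, $0\mapsto1$, $1\mapsto0$. Then $$\pi_{F,\sigma,G}(n)=\frac{1+n(b_1-2)}{2-b_0}$$ for all $n\in\mathbb{Z}_2$. In particular, if $b_0,b_1\in\mathbb{Q}\cap\mathbb{Z}_2$, then $\pi_{F,\sigma,G}(\mathbb{Q}\cap\mathbb{Z}_2)=\mathbb{Q}\cap\mathbb{Z}_2$, and consequently $F$ is ultimately periodic on $\mathbb{Q}\cap\mathbb{Z}_2$ if and only if $G$ is ultimately periodic on $\mathbb{Q}\cap\mathbb{Z}_2$.
   Context: For $a=\sum_{i\ge0}a_i2^i\in\mathbb{Z}_2$ with $a_i\in\{0,1\}$ let $a\,\%\,2:=a_0$. A $2$-fibred function with domain $\mathbb{Z}_2$ is a pair $F=(F[0],F[1])$ of functions $\mathbb{Z}_2\to\mathbb{Z}_2$, regarded also as a function $F:\mathbb{Z}_2\to\mathbb{Z}_2$ by $F(n)=\dfrac{F[n\%2](n)-(F[n\%2](n)\,\%\,2)}{2}$. Only the values of $F[r]$ on $r+2\mathbb{Z}_2$ matter; $F=(a_0+b_0x,a_1+b_1x)$ means that $F[r]$ agrees on $r+2\mathbb{Z}_2$ with the polynomial $a_r+b_rx$ for $r=0,1$ (such $F$ are called linear-polynomial). The $F$-digit expansion of $n$ is $\psi_F(n):=(F^k(n)\,\%\,2)_{k\ge0}$.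 $F$ is a $2$-adic system if for all integers $k\ge0$ and all $m,n\in\mathbb{Z}_2$: $m\equiv n\pmod{2^k}$ if and only if the first $k$ entries of $\psi_F(m)$ and $\psi_F(n)$ coincide. Then $\psi_F$ is a bijection from $\mathbb{Z}_2$ onto the set of infinite $0$-$1$-sequences. For $2$-adic systems $F,G$ and a bijection $\sigma$ of $\{0,1\}$, extended entry-wise to sequences, $\pi_{F,\sigma,G}:=\psi_G^{ -1}\circ\sigma\circ\psi_F:\mathbb{Z}_2\to\mathbb{Z}_2$. A $2$-adic system $F$ is ultimately periodic on a set $A$ if $\{n\in\mathbb{Z}_2\mid\psi_F(n)\text{ is ultimately periodic}\}=A$ (purely periodic sequences count as ultimately periodic). -}

module Defs where

open import Algebra.Definitions using (Invertible)
open import Data.Empty using (⊥-elim)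
open import Data.Fin.Base as Fin using (Fin; zero; suc; toℕ; fromℕ<)
open import Data.Fin.Permutation using (Permutation′; _⟨$⟩ʳ_)
import Data.Fin.Properties as Fin
open import Data.Integer.Base as ℤ using (ℤ; +_)
open import Data.Integer.DivMod using (_%ℕ_; _/ℕ_; n%ℕd<d; a≡a%ℕn+[a/ℕn]*n)
open import Data.Integer.Divisibility.Signed
  using (_∣_; divides; ∣-trans; ∣-reflexive; ∣m∣n⇒∣m+n; ∣m∣n⇒∣m-n; ∣m⇒∣-m;
         ∣n⇒∣m*n; ∣m⇒∣m*n; ∣⇒∣ᵤ; *-cancelˡ-∣)
import Data.Integer.Properties as ℤ
open import Data.Integer.Tactic.RingSolver using (solve-∀)
open import Data.Nat.Base as ℕ using (ℕ; zero; suc; z≤n; s≤s)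
import Data.Nat.Divisibility as ℕ using (∣⇒≤)
open import Data.Nat.GeneralisedArithmetic using (iterate)
import Data.Nat.Properties as ℕ
open import Data.Product.Base using (∃; ∃-syntax; _×_; _,_; proj₁; proj₂)
open import Data.Rational.Base using (ℚ; ↥_; ↧ₙ_)
open import Data.Sum.Base using (inj₁; inj₂)
open import Function.Base using (_∘_)
open import Function.Bundles using (_⇔_; Equivalence; _⟶ₛ_; _⟨$⟩_)
open import Function.Definitions using (Injective; Surjective; Bijective)
open import Level using (0ℓ)
open import Relation.Binary.Bundles using (Setoid)
open import Relation.Binary.PropositionalEquality
open import Relation.Nullary using (¬_; Dec; yes; no)
open import Relation.Unary using (Pred; _∈_; _≐_)

2^_ : ℕ → ℤ
2^ k = (+ 2) ℤ.^ k

-- ℤ₂ is the inverse limit of the rings ℤ/2ᵏ: `residue k` is an integer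
-- representing the class modulo 2ᵏ, so only that class is meaningful.
record ℤ₂ : Set where
  constructor mkℤ₂
  field
    residue  : ℕ → ℤ
    coherent : ∀ k → 2^ k ∣ residue (suc k) ℤ.- residue k

open ℤ₂ public

infix 4 _≡_[mod2^_] _≈ᶻ_

_≡_[mod2^_] : ℤ₂ → ℤ₂ → ℕ → Set
x ≡ y [mod2^ k ] = 2^ k ∣ residue x k ℤ.- residue y k

_≈ᶻ_ : ℤ₂ → ℤ₂ → Set
x ≈ᶻ y = ∀ k → x ≡ y [mod2^ k ]

private abstract
  ∣-by : ∀ {d a b} → a ≡ b → d ∣ a → d ∣ b
  ∣-by eq = subst (_ ∣_) eq

  ∣-zero : ∀ {d} → d ∣ + 0
  ∣-zero = divides (+ 0) refl

  x-x : ∀ x → + 0 ≡ x ℤ.- x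
  x-x = solve-∀

  neg-sub : ∀ x y → ℤ.- (x ℤ.- y) ≡ y ℤ.- x
  neg-sub = solve-∀

  telescope : ∀ x y z → (x ℤ.- y) ℤ.+ (y ℤ.- z) ≡ x ℤ.- z
  telescope = solve-∀

  +-sub : ∀ a b c d → (a ℤ.- b) ℤ.+ (c ℤ.- d) ≡ (a ℤ.+ c) ℤ.- (b ℤ.+ d)
  +-sub = solve-∀

  neg-sub′ : ∀ a b → ℤ.- (a ℤ.- b) ≡ ℤ.- a ℤ.- ℤ.- b
  neg-sub′ = solve-∀

  *-sub : ∀ a b c d → a ℤ.* (c ℤ.- d) ℤ.+ (a ℤ.- b) ℤ.* d ≡ a ℤ.* c ℤ.- b ℤ.* d
  *-sub = solve-∀

≡-mod-refl : ∀ x k → x ≡ x [mod2^ k ]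
≡-mod-refl x k = ∣-by (x-x (residue x k)) ∣-zero

≡-mod-sym : ∀ {x y} k → x ≡ y [mod2^ k ] → y ≡ x [mod2^ k ]
≡-mod-sym {x} {y} k p = ∣-by (neg-sub (residue x k) (residue y k)) (∣m⇒∣-m p)

≡-mod-trans : ∀ {x y z} k → x ≡ y [mod2^ k ] → y ≡ z [mod2^ k ] → x ≡ z [mod2^ k ]
≡-mod-trans {x} {y} {z} k p q =
  ∣-by (telescope (residue x k) (residue y k) (residue z k)) (∣m∣n⇒∣m+n p q)

ℤ₂-setoid : Setoid 0ℓ 0ℓ
ℤ₂-setoid = record
  { Carrier       = ℤ₂
  ; _≈_           = _≈ᶻ_
  ; isEquivalence = record
    { refl  = λ {x} → ≡-mod-refl x
    ; sym   = λ {x} {y} p k → ≡-mod-sym {x} {y} k (p k)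
    ; trans = λ {x} {y} {z} p q k → ≡-mod-trans {x} {y} {z} k (p k) (q k)
    }
  }

infix  8 -ᶻ_
infixl 7 _*ᶻ_
infixl 6 _+ᶻ_ _-ᶻ_

fromℤ : ℤ → ℤ₂
fromℤ i = mkℤ₂ (λ _ → i) (λ _ → ∣-by (x-x i) ∣-zero)

_+ᶻ_ : ℤ₂ → ℤ₂ → ℤ₂
mkℤ₂ x p +ᶻ mkℤ₂ y q = mkℤ₂ (λ k → x k ℤ.+ y k) λ k →
  ∣-by (+-sub (x (suc k)) (x k) (y (suc k)) (y k)) (∣m∣n⇒∣m+n (p k) (q k))

-ᶻ_ : ℤ₂ → ℤ₂
-ᶻ mkℤ₂ x p = mkℤ₂ (λ k → ℤ.- x k) λ k →
  ∣-by (neg-sub′ (x (suc k)) (x k)) (∣m⇒∣-m (p k))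

_-ᶻ_ : ℤ₂ → ℤ₂ → ℤ₂
x -ᶻ y = x +ᶻ (-ᶻ y)

_*ᶻ_ : ℤ₂ → ℤ₂ → ℤ₂
mkℤ₂ x p *ᶻ mkℤ₂ y q = mkℤ₂ (λ k → x k ℤ.* y k) λ k →
  ∣-by (*-sub (x (suc k)) (x k) (y (suc k)) (y k))
       (∣m∣n⇒∣m+n (∣n⇒∣m*n (x (suc k)) (q k)) (∣m⇒∣m*n (y k) (p k)))

Digit : Set
Digit = Fin 2

infixl 7 _%2

_%2 : ℤ₂ → Digit
x %2 = fromℕ< (n%ℕd<d (residue x 1) 2)

fromDigit : Digit → ℤ₂
fromDigit r = fromℤ (+ toℕ r)

private abstract
  2∤1 : ∀ m → ¬ (+ 2 ∣ + 1 ℤ.+ + 2 ℤ.* m)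
  2∤1 m p with ℕ.∣⇒≤ (∣⇒∣ᵤ (∣-by (lem m) (∣m∣n⇒∣m-n p (∣m⇒∣m*n m (∣-reflexive refl)))))
    where
    lem : ∀ m → (+ 1 ℤ.+ + 2 ℤ.* m) ℤ.- + 2 ℤ.* m ≡ + 1
    lem = solve-∀
  ... | s≤s ()

  digits-agree : ∀ {r s} → r ℕ.< 2 → s ℕ.< 2 → ∀ u v →
                 + 2 ∣ (+ r ℤ.+ u ℤ.* + 2) ℤ.- (+ s ℤ.+ v ℤ.* + 2) → r ≡ s
  digits-agree {0} {0} _ _ _ _ _ = refl
  digits-agree {1} {1} _ _ _ _ _ = refl
  digits-agree {1} {0} _ _ u v p = ⊥-elim (2∤1 (u ℤ.- v) (∣-by (lem u v) p))
    where
    lem : ∀ u v → (+ 1 ℤ.+ u ℤ.* + 2) ℤ.- (+ 0 ℤ.+ v ℤ.* + 2) ≡ + 1 ℤ.+ + 2 ℤ.* (u ℤ.- v)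
    lem = solve-∀
  digits-agree {0} {1} _ _ u v p = ⊥-elim (2∤1 (v ℤ.- u) (∣-by (lem u v) (∣m⇒∣-m p)))
    where
    lem : ∀ u v → ℤ.- ((+ 0 ℤ.+ u ℤ.* + 2) ℤ.- (+ 1 ℤ.+ v ℤ.* + 2)) ≡ + 1 ℤ.+ + 2 ℤ.* (v ℤ.- u)
    lem = solve-∀
  digits-agree {suc (suc _)} (s≤s (s≤s ())) _ _ _ _
  digits-agree {_} {suc (suc _)} _ (s≤s (s≤s ())) _ _ _

  halves : ∀ k x y → 2^ (suc k) ∣ x ℤ.- y → 2^ k ∣ x /ℕ 2 ℤ.- y /ℕ 2
  halves k x y p = *-cancelˡ-∣ (+ 2) (∣-by eq p)
    where
    x≡ : x ≡ + (x %ℕ 2) ℤ.+ x /ℕ 2 ℤ.* + 2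
    x≡ = a≡a%ℕn+[a/ℕn]*n x 2
    y≡ : y ≡ + (y %ℕ 2) ℤ.+ y /ℕ 2 ℤ.* + 2
    y≡ = a≡a%ℕn+[a/ℕn]*n y 2
    r≡s : x %ℕ 2 ≡ y %ℕ 2
    r≡s = digits-agree (n%ℕd<d x 2) (n%ℕd<d y 2) (x /ℕ 2) (y /ℕ 2)
            (∣-by (cong₂ ℤ._-_ x≡ y≡) (∣-trans (∣m⇒∣m*n (2^ k) (∣-reflexive refl)) p))
    lem : ∀ r u v → (r ℤ.+ u ℤ.* + 2) ℤ.- (r ℤ.+ v ℤ.* + 2) ≡ + 2 ℤ.* (u ℤ.- v)
    lem = solve-∀
    eq : x ℤ.- y ≡ + 2 ℤ.* (x /ℕ 2 ℤ.- y /ℕ 2)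
    eq = trans (cong₂ ℤ._-_ x≡ (trans y≡ (cong (λ r → + r ℤ.+ y /ℕ 2 ℤ.* + 2) (sym r≡s))))
               (lem (+ (x %ℕ 2)) (x /ℕ 2) (y /ℕ 2))

-- `/ℕ` rounds down, so on the even elements, the only ones to which this is
-- applied below, it is exact division by 2.  One level of precision is lost,
-- hence the shift of the index.
_/2 : ℤ₂ → ℤ₂
mkℤ₂ x p /2 = mkℤ₂ (λ k → x (suc k) /ℕ 2) λ k →
  halves k (x (suc (suc k))) (x (suc k)) (p (suc k))

-- ℚ₂ = ℤ₂ ⊗ ℚ, as fractions with numerator in ℤ₂ and nonzero denominator in ℕ.
-- Since every nonzero element of ℤ₂ is a unit times a power of 2, these
-- fractions already exhaust the fraction field of ℤ₂.
record ℚ₂ : Set where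
  constructor mkℚ₂
  field
    numerator   : ℤ₂
    denominator : ℕ
    .{{nonZero}} : ℕ.NonZero denominator

infix  4 _≈_
infix  8 -_
infixl 7 _*_
infixl 6 _+_ _-_

_≈_ : ℚ₂ → ℚ₂ → Set
mkℚ₂ x d ≈ mkℚ₂ y e = x *ᶻ fromℤ (+ e) ≈ᶻ y *ᶻ fromℤ (+ d)

_+_ : ℚ₂ → ℚ₂ → ℚ₂
mkℚ₂ x d + mkℚ₂ y e =
  mkℚ₂ (x *ᶻ fromℤ (+ e) +ᶻ y *ᶻ fromℤ (+ d)) (d ℕ.* e) {{ℕ.m*n≢0 d e}}

-_ : ℚ₂ → ℚ₂
- mkℚ₂ x d = mkℚ₂ (-ᶻ x) d

_-_ : ℚ₂ → ℚ₂ → ℚ₂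
x - y = x + (- y)

_*_ : ℚ₂ → ℚ₂ → ℚ₂
mkℚ₂ x d * mkℚ₂ y e = mkℚ₂ (x *ᶻ y) (d ℕ.* e) {{ℕ.m*n≢0 d e}}

ι : ℤ₂ → ℚ₂
ι x = mkℚ₂ x 1

fromℚ : ℚ → ℚ₂
fromℚ q = mkℚ₂ (fromℤ (↥ q)) (↧ₙ q)

0ℚ₂ 1ℚ₂ 2ℚ₂ : ℚ₂
0ℚ₂ = ι (fromℤ (+ 0))
1ℚ₂ = ι (fromℤ (+ 1))
2ℚ₂ = ι (fromℤ (+ 2))

Unit : Pred ℚ₂ 0ℓ
Unit = Invertible _≈_ 1ℚ₂ _*_

-- Being nonzero in ℚ₂ is undecidable, so division takes an inverse of the
-- divisor as evidence that it is legitimate.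
infixl 7 _÷_[_]

_÷_[_] : ℚ₂ → (y : ℚ₂) → Unit y → ℚ₂
x ÷ y [ y⁻¹ , _ ] = x * y⁻¹

Rational : Pred ℚ₂ 0ℓ
Rational x = ∃[ q ] x ≈ fromℚ q

Integral : Pred ℚ₂ 0ℓ
Integral x = ∃[ z ] x ≈ ι z

ℚ∩ℤ₂ : Pred ℤ₂ 0ℓ
ℚ∩ℤ₂ z = Rational (ι z)

FibredFunction : Set
FibredFunction = Digit → ℤ₂-setoid ⟶ₛ ℤ₂-setoid

apply : FibredFunction → ℤ₂ → ℤ₂
apply F n = (y -ᶻ fromDigit (y %2)) /2
  where y = F (n %2) ⟨$⟩ n

-- F = (a₀ + b₀ x , a₁ + b₁ x)
IsLinearPolynomial : FibredFunction → (a₀ b₀ a₁ b₁ : ℚ₂) → Set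
IsLinearPolynomial F a₀ b₀ a₁ b₁ =
  (∀ n → n %2 ≡ zero     → ι (F zero ⟨$⟩ n)       ≈ a₀ + b₀ * ι n) ×
  (∀ n → n %2 ≡ suc zero → ι (F (suc zero) ⟨$⟩ n) ≈ a₁ + b₁ * ι n)

DigitSequence : Set
DigitSequence = ℕ → Digit

ψ : FibredFunction → ℤ₂ → DigitSequence
ψ F n k = iterate (apply F) n k %2

IsTwoAdicSystem : FibredFunction → Set
IsTwoAdicSystem F = ∀ k m n →
  m ≡ n [mod2^ k ] ⇔ (∀ i → i ℕ.< k → ψ F m i ≡ ψ F n i)

record TwoAdicSystem : Set where
  field
    function        : FibredFunction
    isTwoAdicSystem : IsTwoAdicSystem function

open TwoAdicSystem public

module _ (F : FibredFunction) (isSystem : IsTwoAdicSystem F) where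

  private
    digits : ∀ k m n → m ≡ n [mod2^ k ] → ∀ i → i ℕ.< k → ψ F m i ≡ ψ F n i
    digits k m n = Equivalence.to (isSystem k m n)

    congruent : ∀ k m n → (∀ i → i ℕ.< k → ψ F m i ≡ ψ F n i) → m ≡ n [mod2^ k ]
    congruent k m n = Equivalence.from (isSystem k m n)

  ψ-cong : ∀ {m n} → m ≈ᶻ n → ψ F m ≗ ψ F n
  ψ-cong {m} {n} m≈n i = digits (suc i) m n (m≈n (suc i)) i ℕ.≤-refl

  ψ-injective : Injective _≈ᶻ_ _≗_ (ψ F)
  ψ-injective {m} {n} eq k = congruent k m n (λ i _ → eq i)

  private
    +-cancel : ∀ a b → b ≡ (a ℤ.+ b) ℤ.- a
    +-cancel = solve-∀

    2^≡ : ∀ k → 2^ k ≡ + (2 ℕ.^ k)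
    2^≡ zero    = refl
    2^≡ (suc k) = trans (cong (+ 2 ℤ.*_) (2^≡ k)) (sym (ℤ.pos-* 2 (2 ℕ.^ k)))

    2^1+k∤2^k : ∀ k → ¬ (2^ (suc k) ∣ 2^ k)
    2^1+k∤2^k k p = ℕ.<⇒≱ (ℕ.^-monoʳ-< 2 (s≤s (s≤s z≤n)) (ℕ.n<1+n k))
      (ℕ.∣⇒≤ {{ℕ.m^n≢0 2 k}} (∣⇒∣ᵤ (subst₂ _∣_ (2^≡ (suc k)) (2^≡ k) p)))

    third : ∀ {a b c : Digit} → a ≢ b → b ≢ c → a ≡ c
    third {zero}     {zero}                a≢b b≢c = ⊥-elim (a≢b refl)
    third {zero}     {suc zero} {zero}     a≢b b≢c = refl
    third {zero}     {suc zero} {suc zero} a≢b b≢c = ⊥-elim (b≢c refl)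
    third {suc zero} {suc zero}            a≢b b≢c = ⊥-elim (a≢b refl)
    third {suc zero} {zero}     {suc zero} a≢b b≢c = refl
    third {suc zero} {zero}     {zero}     a≢b b≢c = ⊥-elim (b≢c refl)

    extend : ∀ (P : ℕ → Set) k → (∀ i → i ℕ.< k → P i) → P k → ∀ i → i ℕ.< suc k → P i
    extend P k below at i (s≤s i≤k) with ℕ.m≤n⇒m<n∨m≡n i≤k
    ... | inj₁ i<k  = below i i<k
    ... | inj₂ refl = at

    digit : ℤ → ℕ → Digit
    digit a = ψ F (fromℤ a)

    shifted : ∀ k a → fromℤ (a ℤ.+ 2^ k) ≡ fromℤ a [mod2^ k ]
    shifted k a = ∣-by (+-cancel a (2^ k)) (∣-reflexive refl)

    shift-keeps : ∀ k a i → i ℕ.< k → digit (a ℤ.+ 2^ k) i ≡ digit a i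
    shift-keeps k a = digits k (fromℤ (a ℤ.+ 2^ k)) (fromℤ a) (shifted k a)

    shift-changes : ∀ k a → digit (a ℤ.+ 2^ k) k ≢ digit a k
    shift-changes k a eq = 2^1+k∤2^k k (∣-by (sym (+-cancel a (2^ k)))
      (congruent (suc k) (fromℤ (a ℤ.+ 2^ k)) (fromℤ a)
        (extend (λ i → digit (a ℤ.+ 2^ k) i ≡ digit a i) k (shift-keeps k a) eq)))

  module _ (s : DigitSequence) where

    private
      Good : ℕ → ℤ → Set
      Good k a = ∀ i → i ℕ.< k → digit a i ≡ s i

      step : ∀ k a → Dec (digit a k ≡ s k) → ℤ
      step k a (yes _) = a
      step k a (no  _) = a ℤ.+ 2^ k

      step-coherent : ∀ k a d → 2^ k ∣ step k a d ℤ.- a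
      step-coherent k a (yes _) = ∣-by (x-x a) ∣-zero
      step-coherent k a (no  _) = shifted k a

      step-good : ∀ k a d → Good k a → Good (suc k) (step k a d)
      step-good k a (yes eq) good = extend (λ i → digit a i ≡ s i) k good eq
      step-good k a (no neq) good = extend (λ i → digit (a ℤ.+ 2^ k) i ≡ s i) k
        (λ i i<k → trans (shift-keeps k a i i<k) (good i i<k))
        (third (shift-changes k a) neq)

      -- An integer whose first k digits under ψ F are those of s.
      approx : ℕ → ℤ
      approx zero    = + 0
      approx (suc k) = step k (approx k) (digit (approx k) k Fin.≟ s k)

      approx-good : ∀ k → Good k (approx k)
      approx-good zero    i ()
      approx-good (suc k) =
        step-good k (approx k) (digit (approx k) k Fin.≟ s k) (approx-good k)

      limit : ℤ₂
      limit = mkℤ₂ approx λ k →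
        step-coherent k (approx k) (digit (approx k) k Fin.≟ s k)

      limit-digits : ψ F limit ≗ s
      limit-digits i = trans
        (digits (suc i) limit (fromℤ (approx (suc i)))
          (∣-by (x-x (approx (suc i))) ∣-zero) i ℕ.≤-refl)
        (approx-good (suc i) i ℕ.≤-refl)

    ψ-onto : ∃[ n ] ψ F n ≗ s
    ψ-onto = limit , limit-digits

  ψ-surjective : Surjective _≈ᶻ_ _≗_ (ψ F)
  ψ-surjective s with ψ-onto s
  ... | n , eq = n , λ m≈n i → trans (ψ-cong m≈n i) (eq i)

  ψ-bijective : Bijective _≈ᶻ_ _≗_ (ψ F)
  ψ-bijective = ψ-injective , ψ-surjective

ψ⁻¹ : TwoAdicSystem → DigitSequence → ℤ₂
ψ⁻¹ F s = proj₁ (proj₂ (ψ-bijective (function F) (isTwoAdicSystem F)) s)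

π : TwoAdicSystem → Permutation′ 2 → TwoAdicSystem → ℤ₂ → ℤ₂
π F σ G n = ψ⁻¹ G ((σ ⟨$⟩ʳ_) ∘ ψ (function F) n)

Image : (ℤ₂ → ℤ₂) → Pred ℤ₂ 0ℓ → Pred ℤ₂ 0ℓ
Image f A m = ∃[ n ] n ∈ A × f n ≈ᶻ m

UltimatelyPeriodic : Pred DigitSequence 0ℓ
UltimatelyPeriodic s = ∃[ N ] ∃[ p ] 0 ℕ.< p × (∀ k → N ℕ.≤ k → s (k ℕ.+ p) ≡ s k)

UltimatelyPeriodicOn : TwoAdicSystem → Pred ℤ₂ 0ℓ → Set
UltimatelyPeriodicOn F A = (λ n → UltimatelyPeriodic (ψ (function F) n)) ≐ A

{-# OPTIONS --safe #-}

-- Being 2-adic systems forces b₀ and b₁ to be odd 2-adic integers, so 2 - b₀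
-- is a unit.  In the form (2 - b₁) n + (2 - b₀) m = 1 the relation between n
-- and m = π n is symmetric under exchanging F and G.  It makes n + m odd and is
-- inherited by F(n), G(m): if n is even and m odd, then
-- 2 ((2 - b₁) F(n) + (2 - b₀) G(m)) = (2 - b₁) b₀ n + (2 - b₀)(1 + b₀ m) = 2.
-- Hence the digits of n and m are opposite at every position.  For rational b₀
-- and b₁ the relation makes n and m rational together.

module Submission where

open import Defs
open import Data.Empty using (⊥)
open import Data.Fin.Base using (zero; suc; toℕ)
open import Data.Fin.Permutation using (Permutation′; _⟨$⟩ʳ_)
import Data.Fin.Properties as Fin
open import Data.Integer.Base as ℤ using (ℤ; +_; -[1+_])
open import Data.Integer.DivMod using (_%ℕ_; _/ℕ_; n%ℕd<d; a≡a%ℕn+[a/ℕn]*n)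
open import Data.Integer.Divisibility.Signed
  using (_∣_; divides; ∣-trans; ∣m∣n⇒∣m+n; ∣n⇒∣m*n; ∣⇒∣ᵤ; ∣-refl;
         *-monoʳ-∣; *-monoˡ-∣; *-cancelˡ-∣)
open import Data.Integer.GCD using (gcd)
import Data.Integer.Properties as ℤ
open import Data.Integer.Tactic.RingSolver using (solve-∀)
open import Data.Nat.Base as ℕ using (ℕ; zero; suc; z≤n; s≤s)
import Data.Nat.Divisibility as ℕ using (∣⇒≤)
import Data.Nat.DivMod as ℕ
import Data.Nat.Properties as ℕ
open import Data.Product.Base using (Σ-syntax; ∃-syntax; _×_; _,_; proj₁; proj₂)
open import Data.Rational.Base as ℚ using (↥_; ↧_; ↧ₙ_)
open import Data.Rational.Properties using (↥-/; ↧-/)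
open import Data.Sum.Base using (inj₁; inj₂)
open import Function.Base using (_∘_)
open import Function.Bundles using (_⇔_; mk⇔; Equivalence; _⟨$⟩_)
open import Level using (0ℓ)
open import Relation.Binary.PropositionalEquality
open import Relation.Nullary using (contradiction)
open import Relation.Unary using (Pred; _∈_; _≐_)

-- Congruences in ℤ₂ are proved at each level k by writing the difference of the
-- two sides as a combination of the differences in the hypotheses.

infixr 6 _⊕_
infixr 7 _⊙_

_⊕_ : ∀ {d a b} → d ∣ a → d ∣ b → d ∣ a ℤ.+ b
_⊕_ = ∣m∣n⇒∣m+n

_⊙_ : ∀ {d b} a → d ∣ b → d ∣ a ℤ.* b
a ⊙ p = ∣n⇒∣m*n a p

∣-by : ∀ {d a b} → a ≡ b → d ∣ a → d ∣ b
∣-by = subst (_ ∣_)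

≡⇒∣- : ∀ {d a b} → a ≡ b → d ∣ a ℤ.- b
≡⇒∣- {a = a} refl = divides (+ 0) (ℤ.+-inverseʳ a)

-- Powers of 2 and odd integers

1∣ : ∀ a → + 1 ∣ a
1∣ a = divides a (sym (ℤ.*-identityʳ a))

2^k∣2^n+k : ∀ n k → 2^ k ∣ 2^ (n ℕ.+ k)
2^k∣2^n+k zero    k = ∣-refl
2^k∣2^n+k (suc n) k = + 2 ⊙ 2^k∣2^n+k n k

n<2^n : ∀ n → n ℕ.< 2 ℕ.^ n
n<2^n zero    = s≤s z≤n
n<2^n (suc n) = ℕ.≤-trans (ℕ.+-mono-≤ (ℕ.m^n>0 2 n) (n<2^n n))
  (ℕ.≤-reflexive (cong (2 ℕ.^ n ℕ.+_) (sym (ℕ.+-identityʳ (2 ℕ.^ n)))))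

-- Truncation of the geometric series u⁻¹ = Σ (1 - u)ⁱ.
inverseMod2^ : ℕ → ℤ → ℤ
inverseMod2^ zero    u = + 0
inverseMod2^ (suc k) u = + 1 ℤ.+ (+ 1 ℤ.- u) ℤ.* inverseMod2^ k u

-- The error satisfies 1 - u vₖ₊₁ = (1 - u)(1 - u vₖ), so each term of the series contributes one
-- more factor 2.
inverseMod2^-inverse : ∀ k u → + 2 ∣ + 1 ℤ.- u → 2^ k ∣ + 1 ℤ.- u ℤ.* inverseMod2^ k u
inverseMod2^-inverse zero    u p = 1∣ _
inverseMod2^-inverse (suc k) u p = ∣-by (lem u (inverseMod2^ k u))
  (∣-trans (*-monoʳ-∣ (+ 2) (inverseMod2^-inverse k u p)) (*-monoˡ-∣ _ p))
  where
  lem : ∀ u v → (+ 1 ℤ.- u) ℤ.* (+ 1 ℤ.- u ℤ.* v) ≡ + 1 ℤ.- u ℤ.* (+ 1 ℤ.+ (+ 1 ℤ.- u) ℤ.* v)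
  lem = solve-∀

cancel-odd-∣ : ∀ k x u → + 2 ∣ + 1 ℤ.- u → 2^ k ∣ x ℤ.* u → 2^ k ∣ x
cancel-odd-∣ k x u odd p =
  ∣-by (lem x u v) (x ⊙ inverseMod2^-inverse k u odd ⊕ v ⊙ p)
  where
  v = inverseMod2^ k u
  lem : ∀ x u v → x ℤ.* (+ 1 ℤ.- u ℤ.* v) ℤ.+ v ℤ.* (x ℤ.* u) ≡ x
  lem = solve-∀

-- The bound d < 2ⁿ keeps the 2-adic valuation of d below n.
cancel-∣ : ∀ n k x d .{{_ : ℕ.NonZero d}} → d ℕ.< 2 ℕ.^ n → 2^ (n ℕ.+ k) ∣ x ℤ.* + d → 2^ k ∣ x
cancel-∣ zero    k x (suc d) (s≤s ()) p
cancel-∣ (suc n) k x d       d<      p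
  with d ℕ.% 2 | d ℕ./ 2 | ℕ.m%n<n d 2 | ℕ.m≡m%n+[m/n]*n d 2
... | zero | zero | _ | refl = contradiction refl (ℕ.≢-nonZero⁻¹ d)
... | zero | q@(suc _) | _ | refl = cancel-∣ n k x q
  (ℕ.*-cancelˡ-< 2 q (2 ℕ.^ n) (subst (ℕ._< 2 ℕ.^ suc n) (ℕ.*-comm q 2) d<))
  (*-cancelˡ-∣ (+ 2) (∣-by (trans (cong (x ℤ.*_) (ℤ.pos-* q 2)) (lem x (+ q))) p))
  where
  lem : ∀ x q → x ℤ.* (q ℤ.* + 2) ≡ + 2 ℤ.* (x ℤ.* q)
  lem = solve-∀
-- An odd d is invertible modulo every power of 2, so the remaining surplus of factors is simply
-- dropped.
... | suc zero | q | _ | refl = ∣-trans (2^k∣2^n+k (suc n) k)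
  (cancel-odd-∣ (suc n ℕ.+ k) x (+ d)
    (divides (ℤ.- + q) (trans (cong (λ t → + 1 ℤ.- (+ 1 ℤ.+ t)) (ℤ.pos-* q 2)) (lem (+ q)))) p)
  where
  lem : ∀ q → + 1 ℤ.- (+ 1 ℤ.+ q ℤ.* + 2) ≡ ℤ.- q ℤ.* + 2
  lem = solve-∀
... | suc (suc _) | _ | s≤s (s≤s ()) | _

-- The ring ℤ₂

private
  0ᶻ 1ᶻ 2ᶻ : ℤ₂
  0ᶻ = fromℤ (+ 0)
  1ᶻ = fromℤ (+ 1)
  2ᶻ = fromℤ (+ 2)

coherent⁺ : ∀ x n k → 2^ k ∣ residue x (n ℕ.+ k) ℤ.- residue x k
coherent⁺ x zero    k = ≡⇒∣- {a = residue x k} refl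
coherent⁺ x (suc n) k =
  ∣-by (lem (residue x (suc n ℕ.+ k)) (residue x (n ℕ.+ k)) (residue x k))
    (∣-trans (2^k∣2^n+k n k) (coherent x (n ℕ.+ k)) ⊕ coherent⁺ x n k)
  where
  lem : ∀ a b c → (a ℤ.- b) ℤ.+ (b ℤ.- c) ≡ a ℤ.- c
  lem = solve-∀

≈ᶻ-sym : ∀ x y → x ≈ᶻ y → y ≈ᶻ x
≈ᶻ-sym x y p k = ≡-mod-sym {x} {y} k (p k)

≈ᶻ-trans : ∀ x y z → x ≈ᶻ y → y ≈ᶻ z → x ≈ᶻ z
≈ᶻ-trans x y z p q k = ≡-mod-trans {x} {y} {z} k (p k) (q k)

-- Dividing by d costs as many levels of precision as d has factors 2. The hypothesis is therefore
-- read n levels higher, with n = d itself large enough since n < 2ⁿ, and coherence brings the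
-- result back to level k.
*ᶻ-cancelʳ : ∀ x y d → d ≢ + 0 → x *ᶻ fromℤ d ≈ᶻ y *ᶻ fromℤ d → x ≈ᶻ y
*ᶻ-cancelʳ x y (+ zero)  d≢0 p = contradiction refl d≢0
*ᶻ-cancelʳ x y (+ suc d) d≢0 p k =
  ∣-by (lem₂ (residue x k) (residue x (n ℕ.+ k)) (residue y k) (residue y (n ℕ.+ k)))
    (cancel-∣ n k (residue x (n ℕ.+ k) ℤ.- residue y (n ℕ.+ k)) n (n<2^n n)
        (∣-by (lem₁ (residue x (n ℕ.+ k)) (residue y (n ℕ.+ k)) (+ n)) (p (n ℕ.+ k)))
      ⊕ (ℤ.-1ℤ ⊙ coherent⁺ x n k) ⊕ coherent⁺ y n k)
  where
  n = suc d
  lem₁ : ∀ a b d → a ℤ.* d ℤ.- b ℤ.* d ≡ (a ℤ.- b) ℤ.* d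
  lem₁ = solve-∀
  lem₂ : ∀ a a′ b b′ → (a′ ℤ.- b′) ℤ.+ (ℤ.-1ℤ ℤ.* (a′ ℤ.- a) ℤ.+ (b′ ℤ.- b)) ≡ a ℤ.- b
  lem₂ = solve-∀
*ᶻ-cancelʳ x y -[1+ d ] d≢0 p = *ᶻ-cancelʳ x y (+ suc d) (λ ()) λ k →
  ∣-by (lem (residue x k) (residue y k) (+ suc d)) (ℤ.-1ℤ ⊙ p k)
  where
  lem : ∀ a b d → ℤ.-1ℤ ℤ.* (a ℤ.* (ℤ.- d) ℤ.- b ℤ.* (ℤ.- d)) ≡ a ℤ.* d ℤ.- b ℤ.* d
  lem = solve-∀

-- Digits

-- `apply F n` unfolds to `half` of the value at n of the branch of F selected by n.
half : ℤ₂ → ℤ₂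
half x = (x -ᶻ fromDigit (x %2)) /2

2∣-⇒≡ : ∀ (r s : Digit) → + 2 ∣ + toℕ r ℤ.- + toℕ s → r ≡ s
2∣-⇒≡ zero       zero       p = refl
2∣-⇒≡ (suc zero) (suc zero) p = refl
2∣-⇒≡ zero       (suc zero) p with ℕ.∣⇒≤ (∣⇒∣ᵤ p)
... | s≤s ()
2∣-⇒≡ (suc zero) zero       p with ℕ.∣⇒≤ (∣⇒∣ᵤ p)
... | s≤s ()

toℕ-%2 : ∀ x → toℕ (x %2) ≡ residue x 1 %ℕ 2
toℕ-%2 x = Fin.toℕ-fromℕ< (n%ℕd<d (residue x 1) 2)

-- The index is `suc k` because the residue at level 0 is an arbitrary integer and says nothing
-- about parity.
2∣x-x%2 : ∀ x k → + 2 ∣ residue x (suc k) ℤ.- + toℕ (x %2)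
2∣x-x%2 x k = ∣-by (lem (residue x (suc k)) (residue x 1) (+ toℕ (x %2)))
  (subst (λ j → + 2 ∣ residue x j ℤ.- residue x 1) (ℕ.+-comm k 1) (coherent⁺ x k 1) ⊕
   divides (residue x 1 /ℕ 2)
     (trans (cong₂ ℤ._-_ (a≡a%ℕn+[a/ℕn]*n (residue x 1) 2) (cong +_ (toℕ-%2 x)))
            (lem′ (+ (residue x 1 %ℕ 2)) (residue x 1 /ℕ 2))))
  where
  lem : ∀ a b c → (a ℤ.- b) ℤ.+ (b ℤ.- c) ≡ a ℤ.- c
  lem = solve-∀
  lem′ : ∀ r q → r ℤ.+ q ℤ.* + 2 ℤ.- r ≡ q ℤ.* + 2
  lem′ = solve-∀

even/ℕ2 : ∀ a → + 2 ∣ a → + 2 ℤ.* (a /ℕ 2) ≡ a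
even/ℕ2 a p with a %ℕ 2 | a /ℕ 2 | n%ℕd<d a 2 | a≡a%ℕn+[a/ℕn]*n a 2
... | zero        | q | _            | refl = lem q
  where
  lem : ∀ q → + 2 ℤ.* q ≡ + 0 ℤ.+ q ℤ.* + 2
  lem = solve-∀
... | suc zero    | q | _            | refl =
  contradiction (2∣-⇒≡ (suc zero) zero (∣-by (lem q) (p ⊕ (ℤ.- q) ⊙ ∣-refl))) λ ()
  where
  lem : ∀ q → (+ 1 ℤ.+ q ℤ.* + 2) ℤ.+ (ℤ.- q) ℤ.* + 2 ≡ + 1
  lem = solve-∀
... | suc (suc _) | _ | s≤s (s≤s ()) | _

-- At level k, `/2` reads the residue at level `suc k`, so the two sides agree only up to coherence.
2*half : ∀ x → 2ᶻ *ᶻ half x ≈ᶻ x -ᶻ fromDigit (x %2)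
2*half x k = ∣-by
  (cong (ℤ._- (residue x k ℤ.- + toℕ (x %2)))
        (sym (even/ℕ2 (residue x (suc k) ℤ.- + toℕ (x %2)) (2∣x-x%2 x k))))
  (∣-by (lem (residue x (suc k)) (residue x k) (+ toℕ (x %2))) (coherent x k))
  where
  lem : ∀ a b d → a ℤ.- b ≡ (a ℤ.- d) ℤ.- (b ℤ.- d)
  lem = solve-∀

-- Later parity computations supply the quotient h explicitly; the congruence is used only modulo 2.
%2-unique : ∀ x r h → x ≈ᶻ fromDigit r +ᶻ 2ᶻ *ᶻ h → x %2 ≡ r
%2-unique x r h p = 2∣-⇒≡ (x %2) r
  (∣-by (lem (residue x 1) (+ toℕ (x %2)) (+ toℕ r) (residue h 1))
    (p 1 ⊕ ℤ.-1ℤ ⊙ 2∣x-x%2 x 0 ⊕ residue h 1 ⊙ ∣-refl))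
  where
  lem : ∀ x s r h → (x ℤ.- (r ℤ.+ + 2 ℤ.* h)) ℤ.+ (ℤ.-1ℤ ℤ.* (x ℤ.- s) ℤ.+ h ℤ.* + 2) ≡ s ℤ.- r
  lem = solve-∀

%2-expand : ∀ x {r} → x %2 ≡ r → x ≈ᶻ fromDigit r +ᶻ 2ᶻ *ᶻ half x
%2-expand x refl k = ∣-by (lem (residue x k) (+ toℕ (x %2)) (residue (half x) k)) (ℤ.-1ℤ ⊙ 2*half x k)
  where
  lem : ∀ x r h → ℤ.-1ℤ ℤ.* (+ 2 ℤ.* h ℤ.- (x ℤ.- r)) ≡ x ℤ.- (r ℤ.+ + 2 ℤ.* h)
  lem = solve-∀

%2-cong : ∀ x y → x ≈ᶻ y → x %2 ≡ y %2
%2-cong x y p = %2-unique x (y %2) (half y)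
  (≈ᶻ-trans x y (fromDigit (y %2) +ᶻ 2ᶻ *ᶻ half y) p (%2-expand y refl))

2*half-even : ∀ x h → x ≈ᶻ 2ᶻ *ᶻ h → 2ᶻ *ᶻ half x ≈ᶻ x
2*half-even x h p k = ∣-by
  (lem (residue x k) (residue (half x) k))
  (ℤ.-1ℤ ⊙ %2-expand x
    (%2-unique x zero h λ j → ∣-by (lem′ (residue x j) (residue h j)) (p j)) k)
  where
  lem : ∀ x h → ℤ.-1ℤ ℤ.* (x ℤ.- (+ 0 ℤ.+ + 2 ℤ.* h)) ≡ + 2 ℤ.* h ℤ.- x
  lem = solve-∀
  lem′ : ∀ x h → x ℤ.- + 2 ℤ.* h ≡ x ℤ.- (+ 0 ℤ.+ + 2 ℤ.* h)
  lem′ = solve-∀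

Odd : ℤ₂ → Set
Odd u = u %2 ≡ suc zero

odd-residue : ∀ u → Odd u → ∀ k → + 2 ∣ + 1 ℤ.- residue u (suc k)
odd-residue u odd k = ∣-by (lem (residue u (suc k)))
  (ℤ.-1ℤ ⊙ subst (λ r → + 2 ∣ residue u (suc k) ℤ.- + toℕ r) odd (2∣x-x%2 u k))
  where
  lem : ∀ u → ℤ.-1ℤ ℤ.* (u ℤ.- + 1) ≡ + 1 ℤ.- u
  lem = solve-∀

odd-inverse : ∀ u → Odd u → ∃[ v ] u *ᶻ v ≈ᶻ 1ᶻ
odd-inverse u odd = mkℤ₂ v v-coherent , λ k →
  ∣-by (lem (residue u k) (v k)) (ℤ.-1ℤ ⊙ inverse k)
  where
  v : ℕ → ℤ
  v k = inverseMod2^ k (residue u k)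

  inverse : ∀ k → 2^ k ∣ + 1 ℤ.- residue u k ℤ.* v k
  inverse zero    = 1∣ _
  inverse (suc k) = inverseMod2^-inverse (suc k) (residue u (suc k)) (odd-residue u odd k)

  lem : ∀ u v → ℤ.-1ℤ ℤ.* (+ 1 ℤ.- u ℤ.* v) ≡ u ℤ.* v ℤ.- + 1
  lem = solve-∀

  lem′ : ∀ u u′ a b → a ℤ.* (+ 1 ℤ.- u ℤ.* b) ℤ.+ ((ℤ.- b) ℤ.* (+ 1 ℤ.- u′ ℤ.* a)
           ℤ.+ (ℤ.- (a ℤ.* b)) ℤ.* (u′ ℤ.- u)) ≡ a ℤ.- b
  lem′ = solve-∀

  -- Inverses modulo 2ᵏ are unique: a - b is a combination of 1 - u b, 1 - u′ a and u′ - u.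
  v-coherent : ∀ k → 2^ k ∣ v (suc k) ℤ.- v k
  v-coherent k = ∣-by (lem′ (residue u k) (residue u (suc k)) (v (suc k)) (v k))
    (v (suc k) ⊙ inverse k ⊕ (ℤ.- v k) ⊙ ∣-trans (2^k∣2^n+k 1 k) (inverse (suc k))
      ⊕ (ℤ.- (v (suc k) ℤ.* v k)) ⊙ coherent u k)

-- The embedding of ℤ₂ into ℚ₂

ι-refl : ∀ a → ι a ≈ ι a
ι-refl a k = ≡⇒∣- {a = residue a k ℤ.* + 1} refl

+-ι : ∀ x y a b → x ≈ ι a → y ≈ ι b → x + y ≈ ι (a +ᶻ b)
+-ι (mkℚ₂ x d) (mkℚ₂ y e) a b p q k =
  ∣-by (trans (lem (residue x k) (residue y k) (residue a k) (residue b k) (+ d) (+ e))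
      (cong (λ c → (residue x k ℤ.* + e ℤ.+ residue y k ℤ.* + d) ℤ.* + 1 ℤ.-
                   (residue a k ℤ.+ residue b k) ℤ.* c) (sym (ℤ.pos-* d e))))
    (+ e ⊙ p k ⊕ + d ⊙ q k)
  where
  lem : ∀ x y a b d e → e ℤ.* (x ℤ.* + 1 ℤ.- a ℤ.* d) ℤ.+ d ℤ.* (y ℤ.* + 1 ℤ.- b ℤ.* e)
        ≡ (x ℤ.* e ℤ.+ y ℤ.* d) ℤ.* + 1 ℤ.- (a ℤ.+ b) ℤ.* (d ℤ.* e)
  lem = solve-∀

-‿ι : ∀ x a → x ≈ ι a → - x ≈ ι (-ᶻ a)
-‿ι (mkℚ₂ x d) a p k = ∣-by (lem (residue x k) (residue a k) (+ d)) (ℤ.-1ℤ ⊙ p k)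
  where
  lem : ∀ x a d → ℤ.-1ℤ ℤ.* (x ℤ.* + 1 ℤ.- a ℤ.* d) ≡ (ℤ.- x) ℤ.* + 1 ℤ.- (ℤ.- a) ℤ.* d
  lem = solve-∀

*-ι : ∀ x y a b → x ≈ ι a → y ≈ ι b → x * y ≈ ι (a *ᶻ b)
*-ι (mkℚ₂ x d) (mkℚ₂ y e) a b p q k =
  ∣-by (trans (lem (residue x k) (residue y k) (residue a k) (residue b k) (+ d) (+ e))
      (cong (λ c → (residue x k ℤ.* residue y k) ℤ.* + 1 ℤ.- (residue a k ℤ.* residue b k) ℤ.* c)
            (sym (ℤ.pos-* d e))))
    (residue y k ⊙ p k ⊕ (residue a k ℤ.* + d) ⊙ q k)
  where
  lem : ∀ x y a b d e → y ℤ.* (x ℤ.* + 1 ℤ.- a ℤ.* d) ℤ.+ (a ℤ.* d) ℤ.* (y ℤ.* + 1 ℤ.- b ℤ.* e)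
        ≡ (x ℤ.* y) ℤ.* + 1 ℤ.- (a ℤ.* b) ℤ.* (d ℤ.* e)
  lem = solve-∀

-- The intermediate fractions have denominator 1, so chaining the equalities leaves no factor to
-- cancel.
≈-via-ι : ∀ x y a b → x ≈ ι a → y ≈ ι b → a ≈ᶻ b → x ≈ y
≈-via-ι (mkℚ₂ x d) (mkℚ₂ y e) a b p q r k =
  ∣-by (lem (residue x k) (residue y k) (residue a k) (residue b k) (+ d) (+ e))
    (+ e ⊙ p k ⊕ (+ d ℤ.* + e) ⊙ r k ⊕ (ℤ.- + d) ⊙ q k)
  where
  lem : ∀ x y a b d e → e ℤ.* (x ℤ.* + 1 ℤ.- a ℤ.* d) ℤ.+ ((d ℤ.* e) ℤ.* (a ℤ.- b)
          ℤ.+ (ℤ.- d) ℤ.* (y ℤ.* + 1 ℤ.- b ℤ.* e)) ≡ x ℤ.* e ℤ.- y ℤ.* d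
  lem = solve-∀

+-nonZero : ∀ d .{{_ : ℕ.NonZero d}} → + d ≢ + 0
+-nonZero d eq = ℕ.≢-nonZero⁻¹ d (ℤ.+-injective eq)

ι-injective : ∀ x a c → x ≈ ι a → ι c ≈ x → c ≈ᶻ a
ι-injective (mkℚ₂ x d) a c p q = *ᶻ-cancelʳ c a (+ d) (+-nonZero d) λ k →
  ∣-by (lem (residue x k) (residue a k) (residue c k) (+ d)) (p k ⊕ q k)
  where
  lem : ∀ x a c d → (x ℤ.* + 1 ℤ.- a ℤ.* d) ℤ.+ (c ℤ.* d ℤ.- x ℤ.* + 1) ≡ c ℤ.* d ℤ.- a ℤ.* d
  lem = solve-∀

-- The coefficients of a linear-polynomial 2-adic system

OddCoefficient : Pred ℚ₂ 0ℓ
OddCoefficient b = ∃[ β ] Odd β × b ≈ ι β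

-- As 4 ≡ 0 mod 4, F(4) = 2b is even like F(0) = 0; so b is integral and F(2) = b,
-- which is odd because 2 ≢ 0 mod 4.
odd-coefficient : ∀ (F : TwoAdicSystem) b →
  (∀ n → n %2 ≡ zero → ι (function F zero ⟨$⟩ n) ≈ 0ℚ₂ + b * ι n) →
  OddCoefficient b
odd-coefficient F (mkℚ₂ x d) lin = β , odd-β , b≈β
  where
  y : ℤ → ℤ₂
  y i = function F zero ⟨$⟩ fromℤ i

  T : ℤ₂ → ℤ₂
  T = apply (function F)

  β : ℤ₂
  β = T 2ᶻ

  -- The linear formula at an even integer i, with denominators cleared.
  y-lin : ∀ i → fromℤ i %2 ≡ zero → y i *ᶻ fromℤ (+ d) ≈ᶻ x *ᶻ fromℤ i
  y-lin i even k = ∣-by (trans (cong (λ c → residue (y i) k ℤ.* + c ℤ.-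
        (+ 0 ℤ.* + (d ℕ.* 1) ℤ.+ (residue x k ℤ.* i) ℤ.* + 1) ℤ.* + 1) d≡)
      (lem (residue (y i) k) (residue x k) (+ d) i (+ (d ℕ.* 1)))) (lin (fromℤ i) even k)
    where
    d≡ : 1 ℕ.* (d ℕ.* 1) ≡ d
    d≡ = trans (ℕ.+-identityʳ (d ℕ.* 1)) (ℕ.*-identityʳ d)
    lem : ∀ y x d i e → y ℤ.* d ℤ.- (+ 0 ℤ.* e ℤ.+ (x ℤ.* i) ℤ.* + 1) ℤ.* + 1 ≡ y ℤ.* d ℤ.- x ℤ.* i
    lem = solve-∀

  y0≈ : y (+ 0) ≈ᶻ 0ᶻ
  y0≈ = *ᶻ-cancelʳ (y (+ 0)) 0ᶻ (+ d) (+-nonZero d) λ k →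
    ∣-by (lem (residue (y (+ 0)) k) (residue x k) (+ d)) (y-lin (+ 0) refl k)
    where
    lem : ∀ y x d → y ℤ.* d ℤ.- x ℤ.* + 0 ≡ y ℤ.* d ℤ.- + 0 ℤ.* d
    lem = solve-∀

  y4≈ : y (+ 4) ≈ᶻ 2ᶻ *ᶻ y (+ 2)
  y4≈ = *ᶻ-cancelʳ (y (+ 4)) (2ᶻ *ᶻ y (+ 2)) (+ d) (+-nonZero d) λ k →
    ∣-by (lem (residue (y (+ 4)) k) (residue (y (+ 2)) k) (residue x k) (+ d))
      (y-lin (+ 4) refl k ⊕ (ℤ.- + 2) ⊙ y-lin (+ 2) refl k)
    where
    lem : ∀ y y′ x d → (y ℤ.* d ℤ.- x ℤ.* + 4) ℤ.+ (ℤ.- + 2) ℤ.* (y′ ℤ.* d ℤ.- x ℤ.* + 2)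
          ≡ y ℤ.* d ℤ.- (+ 2 ℤ.* y′) ℤ.* d
    lem = solve-∀

  halve : ∀ u v → u ≈ᶻ 2ᶻ *ᶻ v → half u ≈ᶻ v
  halve u v p = *ᶻ-cancelʳ (half u) v (+ 2) (λ ()) λ k →
    ∣-by (lem (residue u k) (residue v k) (residue (half u) k)) (2*half-even u v p k ⊕ p k)
    where
    lem : ∀ u v h → (+ 2 ℤ.* h ℤ.- u) ℤ.+ (u ℤ.- + 2 ℤ.* v) ≡ h ℤ.* + 2 ℤ.- v ℤ.* + 2
    lem = solve-∀

  T0-even : T 0ᶻ %2 ≡ zero
  T0-even = %2-cong (T 0ᶻ) 0ᶻ (halve (y (+ 0)) 0ᶻ y0≈)

  -- T(4) = y(2), and 4 ≡ 0 mod 4 makes the digits of 4 and 0 at index 1 equal.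
  y2-even : y (+ 2) %2 ≡ zero
  y2-even = trans (sym (%2-cong (T (fromℤ (+ 4))) (y (+ 2)) (halve (y (+ 4)) (y (+ 2)) y4≈)))
    (trans (Equivalence.to (isTwoAdicSystem F 2 (fromℤ (+ 4)) 0ᶻ) ∣-refl 1 (s≤s (s≤s z≤n))) T0-even)

  odd-β : Odd β
  odd-β with β %2 in eq
  ... | suc zero = refl
  -- If β = T(2) were even, 2 and 0 would share their first two digits, forcing 4 to divide 2.
  ... | zero = contradiction
    (ℕ.∣⇒≤ (∣⇒∣ᵤ (Equivalence.from (isTwoAdicSystem F 2 2ᶻ 0ᶻ) λ
      { 0 _ → refl
      ; 1 _ → trans eq (sym T0-even)
      ; (suc (suc _)) (s≤s (s≤s ())) })))
    λ { (s≤s (s≤s ())) }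

  b≈β : mkℚ₂ x d ≈ ι β
  b≈β = *ᶻ-cancelʳ (x *ᶻ 1ᶻ) (β *ᶻ fromℤ (+ d)) (+ 2) (λ ()) λ k →
    ∣-by (lem (residue (y (+ 2)) k) (residue x k) (residue β k) (+ d))
      (ℤ.-1ℤ ⊙ y-lin (+ 2) refl k ⊕ + d ⊙ %2-expand (y (+ 2)) y2-even k)
    where
    lem : ∀ y x β d → ℤ.-1ℤ ℤ.* (y ℤ.* d ℤ.- x ℤ.* + 2) ℤ.+ d ℤ.* (y ℤ.- (+ 0 ℤ.+ + 2 ℤ.* β))
          ≡ (x ℤ.* + 1) ℤ.* + 2 ℤ.- (β ℤ.* d) ℤ.* + 2
    lem = solve-∀

-- The maps on ℤ₂ and the invariant linking n with its conjugate

-- Stated for 2 T(n), so that a step enters linear combinations without any division.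
Recurrence : ℤ₂ → ℤ₂ → (ℤ₂ → ℤ₂) → Set
Recurrence β₀ β₁ T =
  (∀ n → n %2 ≡ zero     → 2ᶻ *ᶻ T n ≈ᶻ β₀ *ᶻ n) ×
  (∀ n → n %2 ≡ suc zero → 2ᶻ *ᶻ T n ≈ᶻ 1ᶻ +ᶻ β₁ *ᶻ n)

-- No digit has to be subtracted before halving: β₀ n is even along with n, and 1 + β₁ n is even
-- when β₁ and n are odd.
recurrence : ∀ F b₀ b₁ β₀ β₁ → IsLinearPolynomial F 0ℚ₂ b₀ 1ℚ₂ b₁ →
  b₀ ≈ ι β₀ → b₁ ≈ ι β₁ → Odd β₁ → Recurrence β₀ β₁ (apply F)
recurrence F b₀ b₁ β₀ β₁ (lin₀ , lin₁) b₀≈ b₁≈ odd = even-step , odd-step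
  where
  value : ∀ r a b β n → b ≈ ι β → ι (F r ⟨$⟩ n) ≈ ι (fromℤ a) + b * ι n →
          F r ⟨$⟩ n ≈ᶻ fromℤ a +ᶻ β *ᶻ n
  value r a b β n b≈ = ι-injective (ι (fromℤ a) + b * ι n) (fromℤ a +ᶻ β *ᶻ n) (F r ⟨$⟩ n)
    (+-ι (ι (fromℤ a)) (b * ι n) (fromℤ a) (β *ᶻ n) (ι-refl (fromℤ a))
      (*-ι b (ι n) β n b≈ (ι-refl n)))

  double : ∀ n r h z → n %2 ≡ r → F r ⟨$⟩ n ≈ᶻ z → z ≈ᶻ 2ᶻ *ᶻ h → 2ᶻ *ᶻ apply F n ≈ᶻ z
  double n r h z refl p q = ≈ᶻ-trans (2ᶻ *ᶻ half y) y z
    (2*half-even y h (≈ᶻ-trans y z (2ᶻ *ᶻ h) p q)) p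
    where y = F r ⟨$⟩ n

  even-step : ∀ n → n %2 ≡ zero → 2ᶻ *ᶻ apply F n ≈ᶻ β₀ *ᶻ n
  even-step n eq = double n zero (β₀ *ᶻ half n) (β₀ *ᶻ n) eq
    (λ k → ∣-by (lem₁ (residue (F zero ⟨$⟩ n) k) (residue β₀ k) (residue n k))
      (value zero (+ 0) b₀ β₀ n b₀≈ (lin₀ n eq) k))
    (λ k → ∣-by (lem₂ (residue n k) (residue (half n) k) (residue β₀ k))
      (residue β₀ k ⊙ %2-expand n eq k))
    where
    lem₁ : ∀ y b n → y ℤ.- (+ 0 ℤ.+ b ℤ.* n) ≡ y ℤ.- b ℤ.* n
    lem₁ = solve-∀
    lem₂ : ∀ n h b → b ℤ.* (n ℤ.- (+ 0 ℤ.+ + 2 ℤ.* h)) ≡ b ℤ.* n ℤ.- + 2 ℤ.* (b ℤ.* h)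
    lem₂ = solve-∀

  odd-step : ∀ n → n %2 ≡ suc zero → 2ᶻ *ᶻ apply F n ≈ᶻ 1ᶻ +ᶻ β₁ *ᶻ n
  -- With n = 1 + 2h and β₁ = 1 + 2g, the value 1 + β₁ n is 2 (1 + h + g n).
  odd-step n eq = double n (suc zero) (1ᶻ +ᶻ half n +ᶻ half β₁ *ᶻ n) (1ᶻ +ᶻ β₁ *ᶻ n) eq
    (value (suc zero) (+ 1) b₁ β₁ n b₁≈ (lin₁ n eq))
    λ k → ∣-by (lem (residue n k) (residue (half n) k) (residue β₁ k) (residue (half β₁) k))
      (%2-expand n eq k ⊕ residue n k ⊙ %2-expand β₁ odd k)
    where
    lem : ∀ n h b g → (n ℤ.- (+ 1 ℤ.+ + 2 ℤ.* h)) ℤ.+ n ℤ.* (b ℤ.- (+ 1 ℤ.+ + 2 ℤ.* g))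
          ≡ (+ 1 ℤ.+ b ℤ.* n) ℤ.- + 2 ℤ.* (+ 1 ℤ.+ h ℤ.+ g ℤ.* n)
    lem = solve-∀

-- The relation between n and π F σ G n, in a form symmetric in F and G.
Linked : (β₀ β₁ n m : ℤ₂) → Set
Linked β₀ β₁ n m = (2ᶻ -ᶻ β₁) *ᶻ n +ᶻ (2ᶻ -ᶻ β₀) *ᶻ m ≈ᶻ 1ᶻ

linked-sym : ∀ β₀ β₁ n m → Linked β₀ β₁ n m → Linked β₁ β₀ m n
linked-sym β₀ β₁ n m p k =
  ∣-by (lem (residue β₀ k) (residue β₁ k) (residue n k) (residue m k)) (p k)
  where
  lem : ∀ b c n m → ((+ 2 ℤ.- c) ℤ.* n ℤ.+ (+ 2 ℤ.- b) ℤ.* m) ℤ.- + 1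
        ≡ ((+ 2 ℤ.- b) ℤ.* m ℤ.+ (+ 2 ℤ.- c) ℤ.* n) ℤ.- + 1
  lem = solve-∀

-- Solved as m = 1 + (β₁ - 2) n + (β₀ - 1) m, the relation has even terms after the 1.
linked-odd : ∀ β₀ β₁ n m → Odd β₀ → n %2 ≡ zero → Linked β₀ β₁ n m → m %2 ≡ suc zero
linked-odd β₀ β₁ n m odd₀ even p = %2-unique m (suc zero) h λ k →
  ∣-by (lem (residue β₀ k) (residue β₁ k) (residue n k) (residue m k)
            (residue (half n) k) (residue (half β₀) k))
    (p k ⊕ residue m k ⊙ %2-expand β₀ odd₀ k ⊕ (residue β₁ k ℤ.- + 2) ⊙ %2-expand n even k)
  where
  h = (β₁ -ᶻ 2ᶻ) *ᶻ half n +ᶻ half β₀ *ᶻ m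
  lem : ∀ b c n m h g → (((+ 2 ℤ.- c) ℤ.* n ℤ.+ (+ 2 ℤ.- b) ℤ.* m) ℤ.- + 1)
        ℤ.+ (m ℤ.* (b ℤ.- (+ 1 ℤ.+ + 2 ℤ.* g)) ℤ.+ (c ℤ.- + 2) ℤ.* (n ℤ.- (+ 0 ℤ.+ + 2 ℤ.* h)))
        ≡ m ℤ.- (+ 1 ℤ.+ + 2 ℤ.* ((c ℤ.- + 2) ℤ.* h ℤ.+ g ℤ.* m))
  lem = solve-∀

linked-even : ∀ β₀ β₁ n m → Odd β₀ → Odd β₁ → n %2 ≡ suc zero → Linked β₀ β₁ n m → m %2 ≡ zero
linked-even β₀ β₁ n m odd₀ odd₁ odd p = %2-unique m zero h λ k →
  ∣-by (lem (residue β₀ k) (residue β₁ k) (residue n k) (residue m k)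
            (residue (half n) k) (residue (half β₀) k) (residue (half β₁) k))
    (p k ⊕ residue m k ⊙ %2-expand β₀ odd₀ k ⊕ residue n k ⊙ %2-expand β₁ odd₁ k
      ⊕ ℤ.-1ℤ ⊙ %2-expand n odd k)
  where
  -- With n, β₀, β₁ all odd, m = 1 - n + (β₀ - 1) m + (β₁ - 1) n; this is half of it.
  h = half β₀ *ᶻ m +ᶻ half β₁ *ᶻ n -ᶻ half n
  lem : ∀ b c n m h g f → (((+ 2 ℤ.- c) ℤ.* n ℤ.+ (+ 2 ℤ.- b) ℤ.* m) ℤ.- + 1)
        ℤ.+ (m ℤ.* (b ℤ.- (+ 1 ℤ.+ + 2 ℤ.* g)) ℤ.+ (n ℤ.* (c ℤ.- (+ 1 ℤ.+ + 2 ℤ.* f))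
        ℤ.+ ℤ.-1ℤ ℤ.* (n ℤ.- (+ 1 ℤ.+ + 2 ℤ.* h))))
        ≡ m ℤ.- (+ 0 ℤ.+ + 2 ℤ.* ((g ℤ.* m ℤ.+ f ℤ.* n) ℤ.- h))
  lem = solve-∀

linked-step-even : ∀ β₀ β₁ T U → Recurrence β₀ β₁ T → Recurrence β₁ β₀ U →
  ∀ n m → n %2 ≡ zero → m %2 ≡ suc zero → Linked β₀ β₁ n m → Linked β₀ β₁ (T n) (U m)
linked-step-even β₀ β₁ T U recT recU n m even odd p =
  *ᶻ-cancelʳ ((2ᶻ -ᶻ β₁) *ᶻ T n +ᶻ (2ᶻ -ᶻ β₀) *ᶻ U m) 1ᶻ (+ 2) (λ ()) λ k →
    ∣-by (lem (residue β₀ k) (residue β₁ k) (residue n k) (residue m k) (residue (T n) k) (residue (U m) k))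
      -- Adding β₀ times the relation turns the right-hand side into β₀ + (2 - β₀) = 2.
      ((+ 2 ℤ.- residue β₁ k) ⊙ proj₁ recT n even k
        ⊕ (+ 2 ℤ.- residue β₀ k) ⊙ proj₂ recU m odd k ⊕ residue β₀ k ⊙ p k)
  where
  lem : ∀ b c n m n′ m′ → (+ 2 ℤ.- c) ℤ.* (+ 2 ℤ.* n′ ℤ.- b ℤ.* n)
        ℤ.+ ((+ 2 ℤ.- b) ℤ.* (+ 2 ℤ.* m′ ℤ.- (+ 1 ℤ.+ b ℤ.* m))
        ℤ.+ b ℤ.* (((+ 2 ℤ.- c) ℤ.* n ℤ.+ (+ 2 ℤ.- b) ℤ.* m) ℤ.- + 1))
        ≡ ((+ 2 ℤ.- c) ℤ.* n′ ℤ.+ (+ 2 ℤ.- b) ℤ.* m′) ℤ.* + 2 ℤ.- + 1 ℤ.* + 2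
  lem = solve-∀

linked-step : ∀ β₀ β₁ T U → Odd β₀ → Odd β₁ → Recurrence β₀ β₁ T → Recurrence β₁ β₀ U →
  ∀ n m → Linked β₀ β₁ n m → Linked β₀ β₁ (T n) (U m)
linked-step β₀ β₁ T U odd₀ odd₁ recT recU n m p = by-parity (n %2) refl
  where
  by-parity : ∀ r → n %2 ≡ r → Linked β₀ β₁ (T n) (U m)
  by-parity zero even =
    linked-step-even β₀ β₁ T U recT recU n m even (linked-odd β₀ β₁ n m odd₀ even p) p
  -- For odd n the partner m is even, so the even case applies with the two systems exchanged.
  by-parity (suc zero) odd = linked-sym β₁ β₀ (U m) (T n)
    (linked-step-even β₁ β₀ U T recU recT m n (linked-even β₀ β₁ n m odd₀ odd₁ odd p) odd
      (linked-sym β₀ β₁ n m p))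

-- Opposite digits and the candidate for the conjugate

IsSwap : Permutation′ 2 → Set
IsSwap σ = (σ ⟨$⟩ʳ zero ≡ suc zero) × (σ ⟨$⟩ʳ suc zero ≡ zero)

swap-involutive : ∀ σ → IsSwap σ → ∀ r → σ ⟨$⟩ʳ (σ ⟨$⟩ʳ r) ≡ r
swap-involutive σ (σ0 , σ1) zero       = trans (cong (σ ⟨$⟩ʳ_) σ0) σ1
swap-involutive σ (σ0 , σ1) (suc zero) = trans (cong (σ ⟨$⟩ʳ_) σ1) σ0

linked-%2 : ∀ β₀ β₁ n m σ → IsSwap σ → Odd β₀ → Odd β₁ → Linked β₀ β₁ n m →
  m %2 ≡ σ ⟨$⟩ʳ (n %2)
linked-%2 β₀ β₁ n m σ (σ0 , σ1) odd₀ odd₁ p = by-parity (n %2) refl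
  where
  by-parity : ∀ r → n %2 ≡ r → m %2 ≡ σ ⟨$⟩ʳ (n %2)
  by-parity zero eq = trans (linked-odd β₀ β₁ n m odd₀ eq p)
    (sym (trans (cong (σ ⟨$⟩ʳ_) eq) σ0))
  by-parity (suc zero) eq = trans (linked-even β₀ β₁ n m odd₀ odd₁ eq p)
    (sym (trans (cong (σ ⟨$⟩ʳ_) eq) σ1))

linked-digits : ∀ β₀ β₁ F G σ → IsSwap σ → Odd β₀ → Odd β₁ →
  Recurrence β₀ β₁ (apply F) → Recurrence β₁ β₀ (apply G) →
  ∀ n m → Linked β₀ β₁ n m → ψ G m ≗ (σ ⟨$⟩ʳ_) ∘ ψ F n
linked-digits β₀ β₁ F G σ swap odd₀ odd₁ recF recG n m p zero =
  linked-%2 β₀ β₁ n m σ swap odd₀ odd₁ p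
linked-digits β₀ β₁ F G σ swap odd₀ odd₁ recF recG n m p (suc k) =
  -- Digit `suc k` of a point is digit k of its image, and the images are linked again.
  linked-digits β₀ β₁ F G σ swap odd₀ odd₁ recF recG (apply F n) (apply G m)
    (linked-step β₀ β₁ (apply F) (apply G) odd₀ odd₁ recF recG n m p) k

2-odd : ∀ β → Odd β → Odd (2ᶻ -ᶻ β)
2-odd β odd = %2-unique (2ᶻ -ᶻ β) (suc zero) (-ᶻ half β) λ k →
  ∣-by (lem (residue β k) (residue (half β) k)) (ℤ.-1ℤ ⊙ %2-expand β odd k)
  where
  lem : ∀ b g → ℤ.-1ℤ ℤ.* (b ℤ.- (+ 1 ℤ.+ + 2 ℤ.* g))
        ≡ (+ 2 ℤ.- b) ℤ.- (+ 1 ℤ.+ + 2 ℤ.* (ℤ.- g))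
  lem = solve-∀

-- The closed form inside ℤ₂, with v in the role of the inverse of 2 - β₀.
partner : (β₁ v n : ℤ₂) → ℤ₂
partner β₁ v n = (1ᶻ +ᶻ n *ᶻ (β₁ -ᶻ 2ᶻ)) *ᶻ v

partner-linked : ∀ β₀ β₁ v n → (2ᶻ -ᶻ β₀) *ᶻ v ≈ᶻ 1ᶻ → Linked β₀ β₁ n (partner β₁ v n)
partner-linked β₀ β₁ v n inv k =
  ∣-by (lem (residue β₀ k) (residue β₁ k) (residue v k) (residue n k))
    ((+ 1 ℤ.+ residue n k ℤ.* (residue β₁ k ℤ.- + 2)) ⊙ inv k)
  where
  lem : ∀ b c v n → (+ 1 ℤ.+ n ℤ.* (c ℤ.- + 2)) ℤ.* ((+ 2 ℤ.- b) ℤ.* v ℤ.- + 1)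
        ≡ ((+ 2 ℤ.- c) ℤ.* n ℤ.+ (+ 2 ℤ.- b) ℤ.* ((+ 1 ℤ.+ n ℤ.* (c ℤ.- + 2)) ℤ.* v)) ℤ.- + 1
  lem = solve-∀

-- Conjugation of 2-adic systems

π-digits : ∀ F σ G n → ψ (function G) (π F σ G n) ≗ (σ ⟨$⟩ʳ_) ∘ ψ (function F) n
-- Surjectivity speaks of every element equal to the chosen preimage; it is taken at that preimage
-- itself.
π-digits F σ G n = proj₂ (ψ-surjective (function G) (isTwoAdicSystem G) s) {πn} (≡-mod-refl πn)
  where
  s = (σ ⟨$⟩ʳ_) ∘ ψ (function F) n
  πn = π F σ G n

-- Swapping twice restores the digits under G, and these determine m.
π-swap-inverse : ∀ F σ G → IsSwap σ → ∀ m → π F σ G (π G σ F m) ≈ᶻ m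
π-swap-inverse F σ G swap m = ψ-injective (function G) (isTwoAdicSystem G) λ i →
  trans (π-digits F σ G (π G σ F m) i)
    (trans (cong (σ ⟨$⟩ʳ_) (π-digits G σ F m i)) (swap-involutive σ swap (ψ (function G) m i)))

ultimatelyPeriodic-map : ∀ {s t} (f : Digit → Digit) → t ≗ f ∘ s →
  UltimatelyPeriodic s → UltimatelyPeriodic t
ultimatelyPeriodic-map f t≗fs (N , p , p>0 , periodic) = N , p , p>0 , λ k N≤k →
  trans (t≗fs (k ℕ.+ p)) (trans (cong f (periodic k N≤k)) (sym (t≗fs k)))

π-image : ∀ F σ G → IsSwap σ → {A : Pred ℤ₂ 0ℓ} → (∀ x y → x ≈ᶻ y → x ∈ A → y ∈ A) →
  (∀ n → n ∈ A → π F σ G n ∈ A) → (∀ n → n ∈ A → π G σ F n ∈ A) → Image (π F σ G) A ≐ A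
π-image F σ G swap {A} resp closed closed⁻¹ =
  (λ { {m} (n , n∈A , eq) → resp (π F σ G n) m eq (closed n n∈A) }) ,
  (λ {m} m∈A → π G σ F m , closed⁻¹ m m∈A , π-swap-inverse F σ G swap m)

-- Relabelling digits preserves ultimate periodicity, so m under G and its conjugate under F are
-- ultimately periodic together; membership in A is carried across by the closure hypotheses.
π-ultimatelyPeriodicOn : ∀ F σ G → IsSwap σ → {A : Pred ℤ₂ 0ℓ} →
  (∀ x y → x ≈ᶻ y → x ∈ A → y ∈ A) →
  (∀ n → n ∈ A → π F σ G n ∈ A) → (∀ n → n ∈ A → π G σ F n ∈ A) →
  UltimatelyPeriodicOn F A → UltimatelyPeriodicOn G A
π-ultimatelyPeriodicOn F σ G swap {A} resp closed closed⁻¹ (periodic⊆A , A⊆periodic) =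
  (λ {m} periodic → resp (π F σ G (π G σ F m)) m (π-swap-inverse F σ G swap m)
    (closed (π G σ F m)
      (periodic⊆A (ultimatelyPeriodic-map (σ ⟨$⟩ʳ_) (π-digits G σ F m) periodic)))) ,
  (λ {m} m∈A → ultimatelyPeriodic-map (σ ⟨$⟩ʳ_)
    (λ i → trans (sym (swap-involutive σ swap (ψ (function G) m i)))
                 (cong (σ ⟨$⟩ʳ_) (sym (π-digits G σ F m i))))
    (A⊆periodic (closed⁻¹ m m∈A)))

-- Both sides have the swapped F-digits of n as their G-digits, and `ψ` is injective.
π-partner : ∀ β₀ β₁ F G σ → IsSwap σ → Odd β₀ → Odd β₁ →
  Recurrence β₀ β₁ (apply (function F)) → Recurrence β₁ β₀ (apply (function G)) →
  ∀ v n → (2ᶻ -ᶻ β₀) *ᶻ v ≈ᶻ 1ᶻ → π F σ G n ≈ᶻ partner β₁ v n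
π-partner β₀ β₁ F G σ swap odd₀ odd₁ recF recG v n inv =
  ψ-injective (function G) (isTwoAdicSystem G) λ i → trans (π-digits F σ G n i)
    (sym (linked-digits β₀ β₁ (function F) (function G) σ swap odd₀ odd₁ recF recG
      n (partner β₁ v n) (partner-linked β₀ β₁ v n inv) i))

-- Rational 2-adic integers

-- Any nonzero integer may serve as denominator, so arithmetic needs neither lowest terms nor sign
-- bookkeeping.
IsFraction : Pred ℤ₂ 0ℓ
IsFraction z = ∃[ e ] ∃[ p ] e ≢ + 0 × z *ᶻ fromℤ e ≈ᶻ fromℤ p

fraction-resp : ∀ x y → x ≈ᶻ y → IsFraction x → IsFraction y
fraction-resp x y x≈y (e , p , e≢0 , eq) = e , p , e≢0 , λ k →
  ∣-by (lem (residue x k) (residue y k) e p) (eq k ⊕ (ℤ.- e) ⊙ x≈y k)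
  where
  lem : ∀ x y e p → (x ℤ.* e ℤ.- p) ℤ.+ (ℤ.- e) ℤ.* (x ℤ.- y) ≡ y ℤ.* e ℤ.- p
  lem = solve-∀

rational⇒fraction : ∀ x z → x ≈ ι z → Rational x → IsFraction z
rational⇒fraction (mkℚ₂ x d) z x≈z (q , eq) = ↧ q , ↥ q , +-nonZero (↧ₙ q) ,
  *ᶻ-cancelʳ (z *ᶻ fromℤ (↧ q)) (fromℤ (↥ q)) (+ d) (+-nonZero d) λ k →
    ∣-by (lem (residue x k) (residue z k) (+ d) (↧ q) (↥ q)) (eq k ⊕ (ℤ.- (↧ q)) ⊙ x≈z k)
  where
  lem : ∀ x z d e p → (x ℤ.* e ℤ.- p ℤ.* d) ℤ.+ (ℤ.- e) ℤ.* (x ℤ.* + 1 ℤ.- z ℤ.* d)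
        ≡ (z ℤ.* e) ℤ.* d ℤ.- p ℤ.* d
  lem = solve-∀

fraction⇒rational : ∀ z → IsFraction z → z ∈ ℚ∩ℤ₂
fraction⇒rational z (+ zero  , p , e≢0 , eq) = contradiction refl e≢0
fraction⇒rational z (+ suc e , p , e≢0 , eq) =
  q , *ᶻ-cancelʳ (z *ᶻ fromℤ (↧ q)) (fromℤ (↥ q) *ᶻ 1ᶻ) g g≢0 λ k →
    -- Reduction to lowest terms divides p and `suc e` by g, which is cancelled again here.
    ∣-by (trans (cong₂ (λ s t → residue z k ℤ.* s ℤ.- t) (sym (↧-/ p (suc e))) (sym (↥-/ p (suc e))))
                (lem (residue z k) (↧ q) (↥ q) g)) (eq k)
  where
  q = p ℚ./ suc e
  g = gcd p (+ suc e)
  g≢0 : g ≢ + 0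
  g≢0 g≡0 = +-nonZero (suc e) (trans (sym (↧-/ p (suc e)))
    (trans (cong (↧ q ℤ.*_) g≡0) (ℤ.*-zeroʳ (↧ q))))
  lem : ∀ z d n g → z ℤ.* (d ℤ.* g) ℤ.- n ℤ.* g ≡ (z ℤ.* d) ℤ.* g ℤ.- (n ℤ.* + 1) ℤ.* g
  lem = solve-∀
fraction⇒rational z (-[1+ e ] , p , e≢0 , eq) =
  fraction⇒rational z (+ suc e , ℤ.- p , (λ ()) , λ k →
    ∣-by (lem (residue z k) (+ suc e) p) (ℤ.-1ℤ ⊙ eq k))
  where
  lem : ∀ z e p → ℤ.-1ℤ ℤ.* (z ℤ.* (ℤ.- e) ℤ.- p) ≡ z ℤ.* e ℤ.- (ℤ.- p)
  lem = solve-∀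

ℚ∩ℤ₂⇒fraction : ∀ z → z ∈ ℚ∩ℤ₂ → IsFraction z
ℚ∩ℤ₂⇒fraction z = rational⇒fraction (ι z) z (ι-refl z)

ℚ∩ℤ₂-resp : ∀ x y → x ≈ᶻ y → x ∈ ℚ∩ℤ₂ → y ∈ ℚ∩ℤ₂
ℚ∩ℤ₂-resp x y x≈y = fraction⇒rational y ∘ fraction-resp x y x≈y ∘ ℚ∩ℤ₂⇒fraction x

odd≉0 : ∀ u → Odd u → u ≈ᶻ 0ᶻ → ⊥
odd≉0 u odd u≈0 = contradiction (trans (sym odd) (%2-cong u 0ᶻ u≈0)) λ ()

fraction-2- : ∀ x → IsFraction x → IsFraction (2ᶻ -ᶻ x)
fraction-2- x (e , p , e≢0 , eq) = e , + 2 ℤ.* e ℤ.- p , e≢0 , λ k →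
  ∣-by (lem (residue x k) e p) (ℤ.-1ℤ ⊙ eq k)
  where
  lem : ∀ x e p → ℤ.-1ℤ ℤ.* (x ℤ.* e ℤ.- p) ≡ (+ 2 ℤ.- x) ℤ.* e ℤ.- (+ 2 ℤ.* e ℤ.- p)
  lem = solve-∀

*-≢0 : ∀ a b → a ≢ + 0 → b ≢ + 0 → a ℤ.* b ≢ + 0
*-≢0 a b a≢0 b≢0 ab≡0 with ℤ.i*j≡0⇒i≡0∨j≡0 a ab≡0
... | inj₁ a≡0 = a≢0 a≡0
... | inj₂ b≡0 = b≢0 b≡0

fraction-1-* : ∀ x y → IsFraction x → IsFraction y → IsFraction (1ᶻ -ᶻ x *ᶻ y)
fraction-1-* x y (e , p , e≢0 , eq) (f , q , f≢0 , eq′) =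
  e ℤ.* f , e ℤ.* f ℤ.- p ℤ.* q , *-≢0 e f e≢0 f≢0 , λ k →
    ∣-by (lem (residue x k) (residue y k) e f p q)
      ((ℤ.- (residue y k ℤ.* f)) ⊙ eq k ⊕ (ℤ.- p) ⊙ eq′ k)
  where
  lem : ∀ x y e f p q →
    (ℤ.- (y ℤ.* f)) ℤ.* (x ℤ.* e ℤ.- p) ℤ.+ (ℤ.- p) ℤ.* (y ℤ.* f ℤ.- q)
    ≡ (+ 1 ℤ.- x ℤ.* y) ℤ.* (e ℤ.* f) ℤ.- (e ℤ.* f ℤ.- p ℤ.* q)
  lem = solve-∀

fraction-÷-odd : ∀ u m w → Odd u → u *ᶻ m ≈ᶻ w → IsFraction u → IsFraction w → IsFraction m
fraction-÷-odd u m w odd um≈w (e , p , e≢0 , eq) (f , q , f≢0 , eq′) =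
  -- m = w / u = (q / f) / (p / e); the numerator p is nonzero because the odd u is.
  p ℤ.* f , q ℤ.* e , *-≢0 p f p≢0 f≢0 , λ k →
    ∣-by (lem (residue u k) (residue m k) (residue w k) e f p q)
      ((ℤ.- (residue m k ℤ.* f)) ⊙ eq k ⊕ (e ℤ.* f) ⊙ um≈w k ⊕ e ⊙ eq′ k)
  where
  lem : ∀ u m w e f p q → (ℤ.- (m ℤ.* f)) ℤ.* (u ℤ.* e ℤ.- p)
    ℤ.+ ((e ℤ.* f) ℤ.* (u ℤ.* m ℤ.- w) ℤ.+ e ℤ.* (w ℤ.* f ℤ.- q))
    ≡ m ℤ.* (p ℤ.* f) ℤ.- q ℤ.* e
  lem = solve-∀

  p≢0 : p ≢ + 0
  p≢0 refl = odd≉0 u odd (*ᶻ-cancelʳ u 0ᶻ e e≢0 eq)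

-- The relation solved for m: (2 - β₀) m = 1 - (2 - β₁) n, with 2 - β₀ odd.
linked-fraction : ∀ β₀ β₁ n m → Odd β₀ → IsFraction β₀ → IsFraction β₁ →
  Linked β₀ β₁ n m → IsFraction n → IsFraction m
linked-fraction β₀ β₁ n m odd₀ frac₀ frac₁ link fracₙ =
  fraction-÷-odd (2ᶻ -ᶻ β₀) m (1ᶻ -ᶻ (2ᶻ -ᶻ β₁) *ᶻ n) (2-odd β₀ odd₀)
    (λ k → ∣-by (lem ((+ 2 ℤ.- residue β₀ k) ℤ.* residue m k) ((+ 2 ℤ.- residue β₁ k) ℤ.* residue n k))
      (link k))
    (fraction-2- β₀ frac₀) (fraction-1-* (2ᶻ -ᶻ β₁) n (fraction-2- β₁ frac₁) fracₙ)
  where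
  lem : ∀ a b → (b ℤ.+ a) ℤ.- + 1 ≡ a ℤ.- (+ 1 ℤ.- b)
  lem = solve-∀

-- The closed form in ℚ₂ and the rationality of conjugates

2-ι-unit : ∀ b β v → b ≈ ι β → (2ᶻ -ᶻ β) *ᶻ v ≈ᶻ 1ᶻ → Unit (2ℚ₂ - b)
2-ι-unit b β v b≈ inv = ι v ,
  ≈-via-ι (ι v * (2ℚ₂ - b)) 1ℚ₂ (v *ᶻ (2ᶻ -ᶻ β)) 1ᶻ
    (*-ι (ι v) (2ℚ₂ - b) v (2ᶻ -ᶻ β) (ι-refl v) 2-b≈) (ι-refl 1ᶻ) inv′ ,
  ≈-via-ι ((2ℚ₂ - b) * ι v) 1ℚ₂ ((2ᶻ -ᶻ β) *ᶻ v) 1ᶻ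
    (*-ι (2ℚ₂ - b) (ι v) (2ᶻ -ᶻ β) v 2-b≈ (ι-refl v)) (ι-refl 1ᶻ) inv
  where
  2-b≈ : 2ℚ₂ - b ≈ ι (2ᶻ -ᶻ β)
  2-b≈ = +-ι 2ℚ₂ (- b) 2ᶻ (-ᶻ β) (ι-refl 2ᶻ) (-‿ι b β b≈)

  inv′ : v *ᶻ (2ᶻ -ᶻ β) ≈ᶻ 1ᶻ
  inv′ k = ∣-by (cong (ℤ._- + 1) (ℤ.*-comm (+ 2 ℤ.- residue β k) (residue v k))) (inv k)

-- The right-hand side is what division by 2 - b₀ unfolds to when its inverse is `ι v`.
ι-partner : ∀ b β v n m → b ≈ ι β → m ≈ᶻ partner β v n →
  ι m ≈ (1ℚ₂ + ι n * (b - 2ℚ₂)) * ι v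
ι-partner b β v n m b≈ = ≈-via-ι (ι m) ((1ℚ₂ + ι n * (b - 2ℚ₂)) * ι v) m (partner β v n) (ι-refl m)
  (*-ι (1ℚ₂ + ι n * (b - 2ℚ₂)) (ι v) (1ᶻ +ᶻ n *ᶻ (β -ᶻ 2ᶻ)) v
    (+-ι 1ℚ₂ (ι n * (b - 2ℚ₂)) 1ᶻ (n *ᶻ (β -ᶻ 2ᶻ)) (ι-refl 1ᶻ)
      (*-ι (ι n) (b - 2ℚ₂) n (β -ᶻ 2ᶻ) (ι-refl n)
        (+-ι b (- 2ℚ₂) β (-ᶻ 2ᶻ) b≈ (-‿ι 2ℚ₂ 2ᶻ (ι-refl 2ᶻ)))))
    (ι-refl v))

π-closed-form : ∀ b₀ b₁ F G σ → IsSwap σ → OddCoefficient b₀ → OddCoefficient b₁ →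
  IsLinearPolynomial (function F) 0ℚ₂ b₀ 1ℚ₂ b₁ →
  IsLinearPolynomial (function G) 0ℚ₂ b₁ 1ℚ₂ b₀ →
  Σ[ u ∈ Unit (2ℚ₂ - b₀) ] (∀ n →
    ι (π F σ G n) ≈ (1ℚ₂ + ι n * (b₁ - 2ℚ₂)) ÷ (2ℚ₂ - b₀) [ u ])
π-closed-form b₀ b₁ F G σ swap (β₀ , odd₀ , b₀≈) (β₁ , odd₁ , b₁≈) linF linG =
  from-inverse (odd-inverse (2ᶻ -ᶻ β₀) (2-odd β₀ odd₀))
  where
  recF : Recurrence β₀ β₁ (apply (function F))
  recF = recurrence (function F) b₀ b₁ β₀ β₁ linF b₀≈ b₁≈ odd₁

  recG : Recurrence β₁ β₀ (apply (function G))
  recG = recurrence (function G) b₁ b₀ β₁ β₀ linG b₁≈ b₀≈ odd₀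

  from-inverse : ∃[ v ] (2ᶻ -ᶻ β₀) *ᶻ v ≈ᶻ 1ᶻ → Σ[ u ∈ Unit (2ℚ₂ - b₀) ] (∀ n →
    ι (π F σ G n) ≈ (1ℚ₂ + ι n * (b₁ - 2ℚ₂)) ÷ (2ℚ₂ - b₀) [ u ])
  from-inverse (v , inv) = 2-ι-unit b₀ β₀ v b₀≈ inv , λ n →
    ι-partner b₁ β₁ v n (π F σ G n) b₁≈
      (π-partner β₀ β₁ F G σ swap odd₀ odd₁ recF recG v n inv)

π-rational : ∀ b₀ b₁ F G σ → IsSwap σ → OddCoefficient b₀ → OddCoefficient b₁ →
  IsLinearPolynomial (function F) 0ℚ₂ b₀ 1ℚ₂ b₁ →
  IsLinearPolynomial (function G) 0ℚ₂ b₁ 1ℚ₂ b₀ →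
  Rational b₀ → Rational b₁ → ∀ n → n ∈ ℚ∩ℤ₂ → π F σ G n ∈ ℚ∩ℤ₂
π-rational b₀ b₁ F G σ swap (β₀ , odd₀ , b₀≈) (β₁ , odd₁ , b₁≈) linF linG rat₀ rat₁ n n∈ =
  from-inverse (odd-inverse (2ᶻ -ᶻ β₀) (2-odd β₀ odd₀))
  where
  recF : Recurrence β₀ β₁ (apply (function F))
  recF = recurrence (function F) b₀ b₁ β₀ β₁ linF b₀≈ b₁≈ odd₁

  recG : Recurrence β₁ β₀ (apply (function G))
  recG = recurrence (function G) b₁ b₀ β₁ β₀ linG b₁≈ b₀≈ odd₀

  from-inverse : ∃[ v ] (2ᶻ -ᶻ β₀) *ᶻ v ≈ᶻ 1ᶻ → π F σ G n ∈ ℚ∩ℤ₂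
  from-inverse (v , inv) = fraction⇒rational (π F σ G n)
    (fraction-resp m (π F σ G n)
      (≈ᶻ-sym (π F σ G n) m (π-partner β₀ β₁ F G σ swap odd₀ odd₁ recF recG v n inv))
      (linked-fraction β₀ β₁ n m odd₀ (rational⇒fraction b₀ β₀ b₀≈ rat₀)
        (rational⇒fraction b₁ β₁ b₁≈ rat₁) (partner-linked β₀ β₁ v n inv) (ℚ∩ℤ₂⇒fraction n n∈)))
    where
    m : ℤ₂
    m = partner β₁ v n

theorem7p16 : (b₀ b₁ : ℚ₂) (F G : TwoAdicSystem) →
    IsLinearPolynomial (function F) 0ℚ₂ b₀ 1ℚ₂ b₁ →
    IsLinearPolynomial (function G) 0ℚ₂ b₁ 1ℚ₂ b₀ →
    (σ : Permutation′ 2) → σ ⟨$⟩ʳ zero ≡ suc zero → σ ⟨$⟩ʳ suc zero ≡ zero →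
    (Σ[ 2-b₀-unit ∈ Unit (2ℚ₂ - b₀) ] (∀ n →
    ι (π F σ G n) ≈ (1ℚ₂ + ι n * (b₁ - 2ℚ₂)) ÷ (2ℚ₂ - b₀) [ 2-b₀-unit ]))
    × (Rational b₀ × Integral b₀ → Rational b₁ × Integral b₁ →
    (Image (π F σ G) ℚ∩ℤ₂ ≐ ℚ∩ℤ₂)
    × (UltimatelyPeriodicOn F ℚ∩ℤ₂ ⇔ UltimatelyPeriodicOn G ℚ∩ℤ₂))
theorem7p16 b₀ b₁ F G linF linG σ σ0 σ1 =
  π-closed-form b₀ b₁ F G σ swap coeff₀ coeff₁ linF linG , rational-part
  where
  swap : IsSwap σ
  swap = σ0 , σ1

  coeff₀ : OddCoefficient b₀
  coeff₀ = odd-coefficient F b₀ (proj₁ linF)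

  -- b₁ is the coefficient of the even branch of G, so its oddness is read off from G.
  coeff₁ : OddCoefficient b₁
  coeff₁ = odd-coefficient G b₁ (proj₁ linG)

  rational-part : Rational b₀ × Integral b₀ → Rational b₁ × Integral b₁ →
    (Image (π F σ G) ℚ∩ℤ₂ ≐ ℚ∩ℤ₂) ×
    (UltimatelyPeriodicOn F ℚ∩ℤ₂ ⇔ UltimatelyPeriodicOn G ℚ∩ℤ₂)
  rational-part (rat₀ , _) (rat₁ , _) =
    π-image F σ G swap ℚ∩ℤ₂-resp closed closed⁻¹ ,
    mk⇔ (π-ultimatelyPeriodicOn F σ G swap ℚ∩ℤ₂-resp closed closed⁻¹)
        (π-ultimatelyPeriodicOn G σ F swap ℚ∩ℤ₂-resp closed⁻¹ closed)
    where
    closed : ∀ n → n ∈ ℚ∩ℤ₂ → π F σ G n ∈ ℚ∩ℤ₂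
    closed = π-rational b₀ b₁ F G σ swap coeff₀ coeff₁ linF linG rat₀ rat₁

    -- The hypotheses are symmetric under exchanging F with G and b₀ with b₁.
    closed⁻¹ : ∀ n → n ∈ ℚ∩ℤ₂ → π G σ F n ∈ ℚ∩ℤ₂
    closed⁻¹ = π-rational b₁ b₀ G F σ swap coeff₁ coeff₀ linG linF rat₁ rat₀
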